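{- Let $n\geq 1$ and $0\leq i,j\leq n-1$ be integers, and set $$L=\left[\frac{n-1-i}{q}\right]+\left[\frac{n-1-j}{p}\right]+1,$$ where $[\cdot]$ denotes the integer part. If $0\leq\ell\leq L$, then $$\mathcal{D}_{[\ell,i,j,n]}=\mathcal{D}_{[\ell,i,j]}\qquad\text{and}\qquad A_{[\ell,i,j,n]}=A_{[\ell,i,j]}.$$ Moreover, $$A_{i,j}(z)-R_{i,j,n}(z)=O(z^{ -L-2}),\qquad z\rightarrow\infty,$$ that is, in the formal Laurent series $A_{i,j}(z)-R_{i,j,n}(z)$ all coefficients of $z^{m}$ with $m>-L-2$ vanish.
   Context: Fix integers $p,q\geq 1$ and, for each $-p\leq k\leq q$, a bi-infinite sequence $(a^{(k)}_{n})_{n\in\mathbb{Z}}$ of complex numbers. A step is an ordered pair $(n,m)\rightarrow(n+1,m')$ with $n\in\mathbb{Z}_{\geq 0}$, $m,m'\in\mathbb{Z}$ and $-p\leq m'-m\leq q$. Its weight is $a_m^{(i)}$ if $m'=m+i$ with $0\leq i\leq q$, and $a_{m-j}^{(-j)}$ if $m'=m-j$ with $1\leq j\leq p$. A lattice path of length $k$ is a sequence of $k$ steps in which the final vertex of each step is the initial vertex of the next; a path of length zero is a single vertex. The weight $w(\gamma)$ of a path is the product of the weights of its steps ($1$ for length zero). Empty sums are zero. For $\ell,i,j\geq 0$, $\mathcal{D}_{[\ell,i,j]}$ is the collection of all lattice paths of length $\ell$ from $(0,i)$ to $(\ell,j)$ with no point below the $x$-axis. For $n\geq 1$, $0\leq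 i,j\leq n-1$, $\mathcal{D}_{[\ell,i,j,n]}$ is the collection of all lattice paths of length $\ell$ from $(0,i)$ to $(\ell,j)$ with no vertex below the $x$-axis or above the line $y=n-1$. Put $A_{[\ell,i,j]}=\sum_{\gamma\in\mathcal{D}_{[\ell,i,j]}}w(\gamma)$, $A_{[\ell,i,j,n]}=\sum_{\gamma\in\mathcal{D}_{[\ell,i,j,n]}}w(\gamma)$, and $A_{i,j}(z)=\sum_{\ell=0}^{\infty}A_{[\ell,i,j]}z^{ -\ell-1}$ (a formal Laurent series). Let $H_n=(h_{i,j})_{i,j=0}^{n-1}$ be the $n\times n$ matrix with $h_{i,j}=a^{(j-i)}_{\min(i,j)}$ if $-p\leq j-i\leq q$ and $h_{i,j}=0$ otherwise. For $0\leq i,j\leq n-1$, $$R_{i,j,n}(z)=\langle(zI_n-H_n)^{ -1}e_j,e_i\rangle=\sum_{\ell=0}^{\infty}\frac{(H_n^{\ell})_{i,j}}{z^{\ell+1}},$$ a rational function identified with its Laurent expansion at infinity; $\{e_i\}_{i=0}^{n-1}$ is the standard basis of $\mathbb{C}^n$. -}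

module Defs where

open import Algebra.Bundles using (CommutativeRing; AbelianGroup)
import Algebra.Properties.Semiring.Sum as SemiringSum
import Algebra.Properties.Ring as RingProperties
open import Axiom.UniquenessOfIdentityProofs using (module Decidable⇒UIP)
open import Data.Bool.Base using (if_then_else_)
open import Data.Fin.Base as Fin using (Fin; zero; suc; toℕ; fromℕ<)
import Data.Fin.Properties as Fin
open import Data.Integer.Base as ℤ using (ℤ; +_; -[1+_]; 0ℤ; 1ℤ; +<+; -<-; +≤+)
import Data.Integer.Properties as ℤ
open import Algebra.Properties.Group (AbelianGroup.group ℤ.+-0-abelianGroup)
  using () renaming (∙-cancelˡ to ℤ-cancelˡ; ∙-cancelʳ to ℤ-cancelʳ)
open import Data.Integer.Tactic.RingSolver using (solve-∀)
open import Data.List.Base as List using (List; []; _∷_; allFin; concatMap; filter; map)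
open import Data.List.Membership.Propositional using (_∈_)
open import Data.List.Membership.Propositional.Properties
  using (∈-map⁺; ∈-map⁻; ∈-concat⁺′; ∈-allFin)
open import Data.List.Relation.Unary.All as All using (All)
import Data.List.Relation.Unary.All.Properties as All
open import Data.List.Relation.Unary.AllPairs using ([]; _∷_)
import Data.List.Relation.Unary.AllPairs.Properties as AllPairs
open import Data.List.Relation.Unary.Any using (here)
open import Data.List.Relation.Unary.Unique.Propositional using (Unique)
import Data.List.Relation.Unary.Unique.Propositional.Properties as Unique
open import Data.Nat.Base as ℕ using (ℕ; zero; suc; s≤s; z≤n)
import Data.Nat.Properties as ℕ
open import Data.Product using (∃; _×_; _,_; proj₁; proj₂)
import Data.Product.Properties as Product
import Data.Vec.Functional as Vector
open import Function.Base using (_∘_; _$_)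
open import Level using (0ℓ; _⊔_)
open import Relation.Binary.PropositionalEquality as ≡ using (_≡_; refl; cong; cong₂; subst)
open import Relation.Nullary using (Dec; yes; no; does; contradiction)
open import Relation.Nullary.Decidable using (_×-dec_)
open import Relation.Unary using (Pred; Decidable)

module Paths (p q : ℕ) where

  Vertex : Set
  Vertex = ℕ × ℤ

  height : Vertex → ℤ
  height = proj₂

  InRange : ℤ → Set
  InRange k = (ℤ.- (+ p) ℤ.≤ k) × (k ℤ.≤ + q)

  inRange? : Decidable InRange
  inRange? k = (ℤ.- (+ p) ℤ.≤? k) ×-dec (k ℤ.≤? + q)

  -- Inhabited by at most one element, so a path is determined by its vertices.
  record Step (u v : Vertex) : Set where
    constructor step
    field
      next    : proj₁ v ≡ suc (proj₁ u)
      inRange : InRange (height v ℤ.- height u)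

  infixr 5 _◂_

  data Path : ℕ → Vertex → Vertex → Set where
    point : ∀ u → Path 0 u u
    _◂_   : ∀ {ℓ u v w} → Step u v → Path ℓ v w → Path (suc ℓ) u w

  vertices : ∀ {ℓ u v} → Path ℓ u v → List Vertex
  vertices (point u)       = u ∷ []
  vertices (_◂_ {u = u} s γ) = u ∷ vertices γ

  -- A segment joining two points on or above the axis stays on or above it, so
  -- it is enough to constrain the vertices.
  𝒟 : (ℓ i j : ℕ) → Pred (Path ℓ (0 , + i) (ℓ , + j)) 0ℓ
  𝒟 ℓ i j γ = All (λ v → 0ℤ ℤ.≤ height v) (vertices γ)

  𝒟ₙ : (ℓ i j n : ℕ) → Pred (Path ℓ (0 , + i) (ℓ , + j)) 0ℓ
  𝒟ₙ ℓ i j n γ =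
    All (λ v → 0ℤ ℤ.≤ height v × height v ℤ.≤ + n ℤ.- 1ℤ) (vertices γ)

  𝒟? : ∀ ℓ i j → Decidable (𝒟 ℓ i j)
  𝒟? ℓ i j γ = All.all? (λ v → 0ℤ ℤ.≤? height v) (vertices γ)

  𝒟ₙ? : ∀ ℓ i j n → Decidable (𝒟ₙ ℓ i j n)
  𝒟ₙ? ℓ i j n γ = All.all?
    (λ v → (0ℤ ℤ.≤? height v) ×-dec (height v ℤ.≤? + n ℤ.- 1ℤ)) (vertices γ)

  offset : Fin (suc (p ℕ.+ q)) → ℤ
  offset k = + toℕ k ℤ.- + p

  private
    cancel : ∀ m k → (m ℤ.+ k) ℤ.- m ≡ k
    cancel = solve-∀

    uncancel : ∀ m m′ → m ℤ.+ (m′ ℤ.- m) ≡ m′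
    uncancel = solve-∀

    offset-inRange : ∀ k → InRange (offset k)
    offset-inRange k = lower , upper
      where
      open ℤ.≤-Reasoning
      lower : ℤ.- (+ p) ℤ.≤ offset k
      lower = begin
        ℤ.- (+ p)          ≡⟨ ℤ.+-identityˡ _ ⟨
        0ℤ ℤ.- + p         ≤⟨ ℤ.+-monoˡ-≤ (ℤ.- (+ p)) (+≤+ z≤n) ⟩
        + toℕ k ℤ.- + p    ∎
      upper : offset k ℤ.≤ + q
      upper = begin
        + toℕ k ℤ.- + p          ≤⟨ ℤ.+-monoˡ-≤ (ℤ.- (+ p)) (+≤+ (ℕ.s≤s⁻¹ (Fin.toℕ<n k))) ⟩
        + (p ℕ.+ q) ℤ.- + p      ≡⟨ cong (ℤ._- + p) (ℤ.pos-+ p q) ⟩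
        (+ p ℤ.+ + q) ℤ.- + p    ≡⟨ cancel (+ p) (+ q) ⟩
        + q                      ∎

    inRange-offset : ∀ k → InRange k → ∃ λ t → offset t ≡ k
    inRange-offset k (lower , upper) = fromℕ< (s≤s bound) , eq
      where
      shifted : ℤ
      shifted = k ℤ.+ + p
      nonneg : 0ℤ ℤ.≤ shifted
      nonneg = begin
        0ℤ                   ≡⟨ ℤ.+-inverseˡ (+ p) ⟨
        ℤ.- (+ p) ℤ.+ + p    ≤⟨ ℤ.+-monoˡ-≤ (+ p) lower ⟩
        shifted              ∎
        where open ℤ.≤-Reasoning
      abs-shifted : + ℤ.∣ shifted ∣ ≡ shifted
      abs-shifted = ℤ.0≤i⇒+∣i∣≡i nonneg
      bound : ℤ.∣ shifted ∣ ℕ.≤ p ℕ.+ q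
      bound = ℤ.drop‿+≤+ $ begin
        + ℤ.∣ shifted ∣    ≡⟨ abs-shifted ⟩
        k ℤ.+ + p          ≤⟨ ℤ.+-monoˡ-≤ (+ p) upper ⟩
        + q ℤ.+ + p        ≡⟨ ℤ.+-comm (+ q) (+ p) ⟩
        + p ℤ.+ + q        ≡⟨ ℤ.pos-+ p q ⟨
        + (p ℕ.+ q)        ∎
        where open ℤ.≤-Reasoning
      cancelʳ : ∀ x y → (x ℤ.+ y) ℤ.- y ≡ x
      cancelʳ = solve-∀
      eq : offset (fromℕ< (s≤s bound)) ≡ k
      eq = begin
        + toℕ (fromℕ< (s≤s bound)) ℤ.- + p
          ≡⟨ cong (λ t → + t ℤ.- + p) (Fin.toℕ-fromℕ< (s≤s bound)) ⟩
        + ℤ.∣ shifted ∣ ℤ.- + p    ≡⟨ cong (ℤ._- + p) abs-shifted ⟩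
        (k ℤ.+ + p) ℤ.- + p        ≡⟨ cancelʳ k (+ p) ⟩
        k                          ∎
        where open ≡.≡-Reasoning

    offset-injective : ∀ {s t} → offset s ≡ offset t → s ≡ t
    offset-injective eq =
      Fin.toℕ-injective (ℤ.+-injective (ℤ-cancelʳ (ℤ.- (+ p)) _ _ eq))

    Step-irrelevant : ∀ {u v} (s t : Step u v) → s ≡ t
    Step-irrelevant (step e (l , r)) (step e′ (l′ , r′)) =
      cong₂ step (ℕ.≡-irrelevant e e′) (cong₂ _,_ (ℤ.≤-irrelevant l l′) (ℤ.≤-irrelevant r r′))

  target : Vertex → Fin (suc (p ℕ.+ q)) → Vertex
  target (n , m) k = suc n , m ℤ.+ offset k

  stepBy : ∀ u k → Step u (target u k)
  stepBy (n , m) k = step refl $ subst InRange (≡.sym (cancel m (offset k))) (offset-inRange k)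

  _≟ᵛ_ : (u v : Vertex) → Dec (u ≡ v)
  _≟ᵛ_ = Product.≡-dec ℕ._≟_ ℤ._≟_

  -- Sums over sets of paths range over this list, which by ∈-paths and
  -- paths-unique contains every path exactly once.
  paths : ∀ ℓ u v → List (Path ℓ u v)
  paths zero u v with u ≟ᵛ v
  ... | yes refl = point u ∷ []
  ... | no  _    = []
  paths (suc ℓ) u v =
    concatMap (λ k → map (stepBy u k ◂_) (paths ℓ (target u k) v)) (allFin (suc (p ℕ.+ q)))

  private
    step-from : ∀ {u v} (s : Step u v) → ∃ λ k → target u k ≡ v
    step-from {n , m} {_ , m′} (step refl r) with inRange-offset (m′ ℤ.- m) r
    ... | k , eq = k , cong (suc n ,_) (≡.trans (cong (λ t → m ℤ.+ t) eq) (uncancel m m′))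

    second : ∀ {ℓ u v} → Path (suc ℓ) u v → Vertex
    second (_◂_ {v = v} s γ) = v

    ◂-injectiveʳ : ∀ {ℓ u v w} (s : Step u v) {γ δ : Path ℓ v w} → s ◂ γ ≡ s ◂ δ → γ ≡ δ
    ◂-injectiveʳ s refl = refl

    target-injective : ∀ u {s t} → target u s ≡ target u t → s ≡ t
    target-injective (n , m) {s} {t} eq =
      offset-injective (ℤ-cancelˡ m _ _ (cong proj₂ eq))

    second-map : ∀ {ℓ u v k} {γ : Path (suc ℓ) u v} →
                 γ ∈ map (stepBy u k ◂_) (paths ℓ (target u k) v) → second γ ≡ target u k
    second-map {u = u} {k = k} γ∈ with ∈-map⁻ (stepBy u k ◂_) γ∈
    ... | _ , _ , refl = refl

  ∈-paths : ∀ {ℓ u v} (γ : Path ℓ u v) → γ ∈ paths ℓ u v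
  ∈-paths (point u) with u ≟ᵛ u
  ... | yes e rewrite Decidable⇒UIP.≡-irrelevant _≟ᵛ_ e refl = here refl
  ... | no ¬e = contradiction refl ¬e
  ∈-paths (_◂_ {ℓ} {u} {v} {w} s γ) = extend (step-from s) s γ
    where
    branch : Fin (suc (p ℕ.+ q)) → List (Path (suc ℓ) u w)
    branch k = map (stepBy u k ◂_) (paths ℓ (target u k) w)
    extend : ∀ {v} → (∃ λ k → target u k ≡ v) → (s : Step u v) (γ : Path ℓ v w) →
             s ◂ γ ∈ concatMap branch (allFin (suc (p ℕ.+ q)))
    extend (k , refl) s γ rewrite Step-irrelevant s (stepBy u k) =
      ∈-concat⁺′ (∈-map⁺ (stepBy u k ◂_) (∈-paths γ)) (∈-map⁺ branch (∈-allFin k))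

  paths-unique : ∀ ℓ u v → Unique (paths ℓ u v)
  paths-unique zero u v with u ≟ᵛ v
  ... | yes refl = All.[] ∷ []
  ... | no  _    = []
  paths-unique (suc ℓ) u v = Unique.concat⁺
    (All.map⁺ {f = branch} (All.tabulate⁺ λ k →
      Unique.map⁺ (◂-injectiveʳ (stepBy u k)) (paths-unique ℓ (target u k) v)))
    (AllPairs.map⁺ {f = branch} (AllPairs.tabulate⁺ λ s≢t (γ∈s , γ∈t) →
      s≢t (target-injective u (≡.trans (≡.sym (second-map γ∈s)) (second-map γ∈t)))))
    where
    branch : Fin (suc (p ℕ.+ q)) → List (Path (suc ℓ) u v)
    branch k = map (stepBy u k ◂_) (paths ℓ (target u k) v)

module Laurent {c r} (K : CommutativeRing c r) where

  open CommutativeRing K hiding (zero) renaming (refl to ≈-refl; sym to ≈-sym; trans to ≈-trans)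
  open SemiringSum semiring using (sum; sum-cong-≋; *-distribˡ-sum; ∑-comm;
    sum-replicate-zero)

  -- Formal Laurent series in z⁻¹: only finitely many positive powers of z occur.
  -- The bound is part of the data but plays no role in equality.
  record Series : Set (c ⊔ r) where
    field
      coeff    : ℤ → Carrier
      bound    : ℤ
      vanishes : ∀ m → bound ℤ.< m → coeff m ≈ 0#

  open Series public

  infix  4 _≈ˢ_ _=O[z^_]
  infixl 6 _+ˢ_ _-ˢ_
  infixr 7 _•_

  _≈ˢ_ : Series → Series → Set r
  f ≈ˢ g = ∀ m → coeff f m ≈ coeff g m

  _=O[z^_] : Series → ℤ → Set r
  f =O[z^ k ] = ∀ m → k ℤ.< m → coeff f m ≈ 0#

  constˢ : Carrier → Series
  constˢ x .coeff (+ zero)    = x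
  constˢ x .coeff (+ (suc _)) = 0#
  constˢ x .coeff -[1+ _ ]    = 0#
  constˢ x .bound = 0ℤ
  constˢ x .vanishes (+ suc _) _ = ≈-refl
  constˢ x .vanishes (+ zero) (+<+ ())

  0ˢ : Series
  0ˢ .coeff _      = 0#
  0ˢ .bound        = 0ℤ
  0ˢ .vanishes _ _ = ≈-refl

  _+ˢ_ : Series → Series → Series
  (f +ˢ g) .coeff m = coeff f m + coeff g m
  (f +ˢ g) .bound   = bound f ℤ.⊔ bound g
  (f +ˢ g) .vanishes m b<m = ≈-trans
    (+-cong (vanishes f m (ℤ.≤-<-trans (ℤ.i≤i⊔j (bound f) (bound g)) b<m))
            (vanishes g m (ℤ.≤-<-trans (ℤ.i≤j⊔i (bound f) (bound g)) b<m)))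
    (+-identityˡ 0#)

  _-ˢ_ : Series → Series → Series
  (f -ˢ g) .coeff m = coeff f m - coeff g m
  (f -ˢ g) .bound   = bound f ℤ.⊔ bound g
  (f -ˢ g) .vanishes m b<m = ≈-trans
    (+-cong (vanishes f m (ℤ.≤-<-trans (ℤ.i≤i⊔j (bound f) (bound g)) b<m))
            (-‿cong (vanishes g m (ℤ.≤-<-trans (ℤ.i≤j⊔i (bound f) (bound g)) b<m))))
    (-‿inverseʳ 0#)

  _•_ : Carrier → Series → Series
  (x • f) .coeff m        = x * coeff f m
  (x • f) .bound          = bound f
  (x • f) .vanishes m b<m = ≈-trans (*-congˡ (vanishes f m b<m)) (zeroʳ x)

  z·_ : Series → Series
  (z· f) .coeff m        = coeff f (m ℤ.- 1ℤ)
  (z· f) .bound          = bound f ℤ.+ 1ℤ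
  (z· f) .vanishes m b<m = vanishes f (m ℤ.- 1ℤ)
    (subst (ℤ._< m ℤ.- 1ℤ) (cancel (bound f)) (ℤ.+-monoˡ-< (ℤ.- 1ℤ) b<m))
    where
    cancel : ∀ x → (x ℤ.+ 1ℤ) ℤ.- 1ℤ ≡ x
    cancel = solve-∀

  sumˢ : ∀ {n} → (Fin n → Series) → Series
  sumˢ = Vector.foldr _+ˢ_ 0ˢ

  -- ∑_{ℓ ≥ 0} x ℓ z^{-ℓ-1}
  ∑z^-ℓ-1 : (ℕ → Carrier) → Series
  ∑z^-ℓ-1 x .coeff (+ _)    = 0#
  ∑z^-ℓ-1 x .coeff -[1+ ℓ ] = x ℓ
  ∑z^-ℓ-1 x .bound = ℤ.-1ℤ
  ∑z^-ℓ-1 x .vanishes (+ _) _ = ≈-refl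
  ∑z^-ℓ-1 x .vanishes -[1+ _ ] (-<- ())

  Matrix : ℕ → Set c
  Matrix n = Fin n → Fin n → Carrier

  Matrixˢ : ℕ → Set (c ⊔ r)
  Matrixˢ n = Fin n → Fin n → Series

  δ : ∀ {n} → Matrix n
  δ i j = if does (i Fin.≟ j) then 1# else 0#

  -- The product (z I − M) R, where z I and M act by multiplication by z and by
  -- scalars; similarly on the right.
  [z−_]·_ : ∀ {n} → Matrix n → Matrixˢ n → Matrixˢ n
  ([z− M ]· R) i j = z· R i j -ˢ sumˢ (λ k → M i k • R k j)

  _·[z−_] : ∀ {n} → Matrixˢ n → Matrix n → Matrixˢ n
  (R ·[z− M ]) i j = z· R i j -ˢ sumˢ (λ k → M k j • R i k)

  -- R = (z I − M)⁻¹. Such an R is unique, being a two-sided inverse, so it is the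
  -- expansion at infinity of the inverse over rational functions; it exists by
  -- expansion-isResolvent.
  record IsResolvent {n} (M : Matrix n) (R : Matrixˢ n) : Set r where
    field
      inverseʳ : ∀ i j → ([z− M ]· R) i j ≈ˢ constˢ (δ i j)
      inverseˡ : ∀ i j → (R ·[z− M ]) i j ≈ˢ constˢ (δ i j)

  _^ᴹ_ : ∀ {n} → Matrix n → ℕ → Matrix n
  (M ^ᴹ zero)  = δ
  (M ^ᴹ suc ℓ) = λ i j → sum (λ k → M i k * (M ^ᴹ ℓ) k j)

  expansion : ∀ {n} → Matrix n → Matrixˢ n
  expansion M i j = ∑z^-ℓ-1 (λ ℓ → (M ^ᴹ ℓ) i j)

  private
    coeff-sumˢ : ∀ {n} (f : Fin n → Series) m → coeff (sumˢ f) m ≡ sum (λ k → coeff (f k) m)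
    coeff-sumˢ {zero}  f m = refl
    coeff-sumˢ {suc n} f m = cong (λ t → coeff (f zero) m + t) (coeff-sumˢ (f ∘ suc) m)

    sum-cong : ∀ n {f g : Fin n → Carrier} → (∀ k → f k ≈ g k) → sum f ≈ sum g
    sum-cong n {f} {g} = sum-cong-≋ {n} {f} {g}

    sum-zero : ∀ n (f : Fin n → Carrier) → (∀ k → f k ≈ 0#) → sum f ≈ 0#
    sum-zero n f f≈0 = ≈-trans (sum-cong n {f} f≈0) (sum-replicate-zero n)

    δ-sumˡ : ∀ {n} (i : Fin n) (x : Fin n → Carrier) → sum (λ k → δ i k * x k) ≈ x i
    δ-sumˡ {suc n} zero x = ≈-trans
      (+-cong (*-identityˡ _) (sum-zero n (λ k → 0# * x (suc k)) (λ k → zeroˡ _)))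
      (+-identityʳ _)
    δ-sumˡ (suc i) x = ≈-trans
      (+-cong (zeroˡ _) (δ-sumˡ i (x ∘ suc))) (+-identityˡ _)

    δ-sumʳ : ∀ {n} (j : Fin n) (x : Fin n → Carrier) → sum (λ k → x k * δ k j) ≈ x j
    δ-sumʳ {suc n} zero x = ≈-trans
      (+-cong (*-identityʳ _) (sum-zero n (λ k → x (suc k) * 0#) (λ k → zeroʳ _)))
      (+-identityʳ _)
    δ-sumʳ (suc j) x = ≈-trans
      (+-cong (zeroʳ _) (δ-sumʳ j (x ∘ suc))) (+-identityˡ _)

    power-comm : ∀ {n} (M : Matrix n) ℓ i j →
      sum (λ k → M i k * (M ^ᴹ ℓ) k j) ≈ sum (λ k → M k j * (M ^ᴹ ℓ) i k)
    power-comm {n} M zero i j = begin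
      sum (λ k → M i k * δ k j)    ≈⟨ δ-sumʳ j (M i) ⟩
      M i j                        ≈⟨ δ-sumˡ i (λ k → M k j) ⟨
      sum (λ k → δ i k * M k j)    ≈⟨ sum-cong n (λ k → *-comm (δ i k) (M k j)) ⟩
      sum (λ k → M k j * δ i k)    ∎
      where open import Relation.Binary.Reasoning.Setoid setoid
    power-comm {n} M (suc ℓ) i j = begin
      sum (λ k → M i k * (M ^ᴹ suc ℓ) k j)
        ≈⟨ sum-cong n (λ k → *-congˡ (power-comm M ℓ k j)) ⟩
      sum (λ k → M i k * sum (λ t → M t j * (M ^ᴹ ℓ) k t))
        ≈⟨ sum-cong n (λ k → *-distribˡ-sum {n} (M i k) (λ t → M t j * (M ^ᴹ ℓ) k t)) ⟩
      sum (λ k → sum (λ t → M i k * (M t j * (M ^ᴹ ℓ) k t)))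
        ≈⟨ ∑-comm {n} {n} (λ k t → M i k * (M t j * (M ^ᴹ ℓ) k t)) ⟩
      sum (λ t → sum (λ k → M i k * (M t j * (M ^ᴹ ℓ) k t)))
        ≈⟨ sum-cong n (λ t → sum-cong n (λ k → swap (M i k) (M t j) ((M ^ᴹ ℓ) k t))) ⟩
      sum (λ t → sum (λ k → M t j * (M i k * (M ^ᴹ ℓ) k t)))
        ≈⟨ sum-cong n (λ t → *-distribˡ-sum {n} (M t j) (λ k → M i k * (M ^ᴹ ℓ) k t)) ⟨
      sum (λ t → M t j * (M ^ᴹ suc ℓ) i t)    ∎
      where
      open import Relation.Binary.Reasoning.Setoid setoid
      swap : ∀ x y w → x * (y * w) ≈ y * (x * w)
      swap x y w = ≈-trans (≈-sym (*-assoc x y w))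
        (≈-trans (*-congʳ (*-comm x y)) (*-assoc y x w))

    sub-zero : ∀ {x y} → y ≈ 0# → x - y ≈ x
    sub-zero {x} y≈0 = ≈-trans
      (+-congˡ (≈-trans (-‿cong y≈0) (RingProperties.-0#≈0# ring))) (+-identityʳ x)

    sub-self : ∀ {x y} → x ≈ y → x - y ≈ 0#
    sub-self x≈y = ≈-trans (+-congʳ x≈y) (-‿inverseʳ _)

    -- z ∑ x ℓ z^{-ℓ-1} − S = x 0 when S = ∑ x (ℓ+1) z^{-ℓ-1}.
    telescope : (x : ℕ → Carrier) (S : Series) →
      (∀ m → coeff S (+ m) ≈ 0#) → (∀ ℓ → coeff S -[1+ ℓ ] ≈ x (suc ℓ)) →
      (z· ∑z^-ℓ-1 x -ˢ S) ≈ˢ constˢ (x 0)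
    telescope x S pos neg (+ zero)    = sub-zero (pos 0)
    telescope x S pos neg (+ (suc m)) = sub-zero (pos (suc m))
    telescope x S pos neg -[1+ ℓ ] rewrite ℕ.+-identityʳ ℓ = sub-self (≈-sym (neg ℓ))

    scaled-sum-pos : ∀ {n} (x : Fin n → Carrier) (y : Fin n → ℕ → Carrier) m →
      coeff (sumˢ (λ k → x k • ∑z^-ℓ-1 (y k))) (+ m) ≈ 0#
    scaled-sum-pos {n} x y m = ≈-trans
      (reflexive (coeff-sumˢ (λ k → x k • ∑z^-ℓ-1 (y k)) (+ m))) (sum-zero n (λ k → x k * 0#) (λ k → zeroʳ (x k)))

  expansion-isResolvent : ∀ {n} (M : Matrix n) → IsResolvent M (expansion M)
  expansion-isResolvent M .IsResolvent.inverseʳ i j =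
    telescope (λ ℓ → (M ^ᴹ ℓ) i j) (sumˢ (λ k → M i k • expansion M k j))
      (scaled-sum-pos (M i) (λ k ℓ → (M ^ᴹ ℓ) k j))
      (λ ℓ → reflexive (coeff-sumˢ (λ k → M i k • expansion M k j) -[1+ ℓ ]))
  expansion-isResolvent M .IsResolvent.inverseˡ i j =
    telescope (λ ℓ → (M ^ᴹ ℓ) i j) (sumˢ (λ k → M k j • expansion M i k))
      (scaled-sum-pos (λ k → M k j) (λ k ℓ → (M ^ᴹ ℓ) i k))
      (λ ℓ → ≈-trans (reflexive (coeff-sumˢ (λ k → M k j • expansion M i k) -[1+ ℓ ]))
                     (≈-sym (power-comm M ℓ i j)))

-- a k n stands for a_n^{(k)}; only its values at −p ≤ k ≤ q are ever used.
module Weights {c r} (K : CommutativeRing c r) (p q : ℕ)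
               (a : ℤ → ℤ → CommutativeRing.Carrier K) where

  open CommutativeRing K using (Carrier; _+_; _*_; 0#; 1#)
  open Paths p q public
  open Laurent K public

  stepWeight : (m m′ : ℤ) → Carrier
  stepWeight m m′ with m′ ℤ.- m
  ... | + i      = a (+ i) m
  ... | -[1+ j ] = a -[1+ j ] (m ℤ.- + suc j)

  weight : ∀ {ℓ u v} → Path ℓ u v → Carrier
  weight (point u)                 = 1#
  weight (_◂_ {u = u} {v = v} s γ) = stepWeight (height u) (height v) * weight γ

  sumOver : ∀ {ℓ u v} {P : Pred (Path ℓ u v) 0ℓ} → Decidable P → Carrier
  sumOver {ℓ} {u} {v} P? = List.foldr _+_ 0# (map weight (filter P? (paths ℓ u v)))

  A : (ℓ i j : ℕ) → Carrier
  A ℓ i j = sumOver (𝒟? ℓ i j)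

  Aₙ : (ℓ i j n : ℕ) → Carrier
  Aₙ ℓ i j n = sumOver (𝒟ₙ? ℓ i j n)

  A[z] : (i j : ℕ) → Series
  A[z] i j = ∑z^-ℓ-1 (λ ℓ → A ℓ i j)

  H : (n : ℕ) → Matrix n
  H n i j =
    if does (inRange? (+ toℕ j ℤ.- + toℕ i))
    then a (+ toℕ j ℤ.- + toℕ i) (+ (toℕ i ℕ.⊓ toℕ j))
    else 0#

{-# OPTIONS --safe #-}

-- A step rises by at most q and falls by at most p, so a path from height i to
-- height j that reaches height n has made at least ⌊(n-1-i)/q⌋ + 1 steps before
-- and makes at least ⌊(n-1-j)/p⌋ + 1 steps after: its length exceeds L.  Paths of
-- length at most L therefore do not see the ceiling y = n - 1.  Splitting off the
-- first step shows that A_{[ℓ,i,j,n]} and (H_n^ℓ)_{i,j} satisfy the same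
-- recurrence, and R_{i,j,n} is the power series of the latter since a resolvent
-- is determined coefficient by coefficient, downwards from its highest power of z.
module Submission where

open import Algebra.Bundles using (CommutativeRing; AbelianGroup)
import Algebra.Properties.Group as GroupProperties
import Algebra.Properties.Ring as RingProperties
import Algebra.Properties.Semiring.Sum as SemiringSum
open import Data.Bool.Base using (if_then_else_; true; false)
open import Data.Fin.Base as Fin using (Fin; toℕ; fromℕ<; zero; suc)
import Data.Fin.Properties as Fin
open import Data.Integer.Base as ℤ using (ℤ; +_; -[1+_]; 0ℤ; 1ℤ; +≤+)
import Data.Integer.Properties as ℤ
open import Data.Integer.Tactic.RingSolver using (solve-∀)
open import Data.List.Base as List using (List; []; _∷_; _++_; concatMap; filter; map; tabulate)
open import Data.List.Membership.Propositional.Properties using (∈-concatMap⁻; ∈-map⁻)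
import Data.List.Properties as List
open import Data.List.Relation.Unary.All as All using (All; []; _∷_)
import Data.List.Relation.Unary.Any as Any
open import Data.Nat.Base as ℕ using (ℕ; NonZero; _+_; _∸_; _/_; _≤_; _≥_; zero; suc; s≤s; z≤n)
import Data.Nat.DivMod as ℕ
import Data.Nat.Properties as ℕ
open import Data.Product using (_×_; _,_; proj₁; proj₂; ∃; ∃₂)
open import Function.Base using (_∘_)
open import Level using (0ℓ)
open import Relation.Binary.PropositionalEquality as ≡ using (_≡_; _≢_; refl; cong; subst)
open import Relation.Nullary using (¬_; Dec; yes; no; does; contradiction)
open import Relation.Nullary.Decidable using (_×-dec_; dec-true; dec-false)
open import Relation.Unary using (Pred; Decidable; _≐_)
open import Defs

open GroupProperties (AbelianGroup.group ℤ.+-0-abelianGroup)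
  using () renaming (∙-cancelˡ to ℤ-cancelˡ; ∙-cancelʳ to ℤ-cancelʳ)

-- Integer inequalities and heights in the strip.

m+[n-m]≡n : ∀ m n → m ℤ.+ (n ℤ.- m) ≡ n
m+[n-m]≡n = solve-∀

m-n≤o⇒m≤n+o : ∀ m n {o} → m ℤ.- n ℤ.≤ o → m ℤ.≤ n ℤ.+ o
m-n≤o⇒m≤n+o m n {o} le = begin
  m                  ≡⟨ m+[n-m]≡n n m ⟨
  n ℤ.+ (m ℤ.- n)    ≤⟨ ℤ.+-monoʳ-≤ n le ⟩
  n ℤ.+ o            ∎
  where open ℤ.≤-Reasoning

i≤+∣i∣ : ∀ i → i ℤ.≤ + ℤ.∣ i ∣
i≤+∣i∣ (+ _)    = ℤ.≤-refl
i≤+∣i∣ -[1+ _ ] = ℤ.-≤+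

Within : ℕ → Pred (ℕ × ℤ) 0ℓ
Within n w = 0ℤ ℤ.≤ proj₂ w × proj₂ w ℤ.≤ + n ℤ.- 1ℤ

within? : ∀ n → Decidable (Within n)
within? n w = (0ℤ ℤ.≤? proj₂ w) ×-dec (proj₂ w ℤ.≤? + n ℤ.- 1ℤ)

within-toℕ : ∀ {n} s (i : Fin n) → Within n (s , + toℕ i)
within-toℕ {suc n} s i = +≤+ z≤n , +≤+ (ℕ.s≤s⁻¹ (Fin.toℕ<n i))

toℕ-within : ∀ n {w} → Within n w → ∃ λ (k : Fin n) → proj₂ w ≡ + toℕ k
toℕ-within zero    {_ , + _}      (_ , ())
toℕ-within (suc n) {_ , + h}      (_ , +≤+ h≤n) =
  fromℕ< (s≤s h≤n) , cong +_ (≡.sym (Fin.toℕ-fromℕ< (s≤s h≤n)))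

-- Height bounds along a path.

module _ {p q : ℕ} where

  open Paths p q

  step-rise : ∀ {u v} → Step u v → height v ℤ.≤ height u ℤ.+ + q
  step-rise {u} {v} s = m-n≤o⇒m≤n+o (height v) (height u) (proj₂ (Step.inRange s))

  step-fall : ∀ {u v} → Step u v → height u ℤ.≤ height v ℤ.+ + p
  step-fall {u} {v} s = begin
    height u                                    ≡⟨ eq (height u) (height v) ⟩
    height v ℤ.+ ℤ.- (height v ℤ.- height u)
      ≤⟨ ℤ.+-monoʳ-≤ (height v) (ℤ.neg-mono-≤ (proj₁ (Step.inRange s))) ⟩
    height v ℤ.+ ℤ.- (ℤ.- + p)                  ≡⟨ cong (λ x → height v ℤ.+ x) (ℤ.neg-involutive (+ p)) ⟩
    height v ℤ.+ + p                            ∎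
    where
    open ℤ.≤-Reasoning
    eq : ∀ m n → m ≡ n ℤ.+ ℤ.- (n ℤ.- m)
    eq = solve-∀

  ends-fall : ∀ {ℓ u v} → Path ℓ u v → height u ℤ.≤ height v ℤ.+ + (ℓ ℕ.* p)
  ends-fall (point u) = ℤ.≤-reflexive (≡.sym (ℤ.+-identityʳ (height u)))
  ends-fall (_◂_ {ℓ} {u} {v} {w} s γ) = begin
    height u                                    ≤⟨ step-fall s ⟩
    height v ℤ.+ + p                            ≤⟨ ℤ.+-monoˡ-≤ (+ p) (ends-fall γ) ⟩
    (height w ℤ.+ + (ℓ ℕ.* p)) ℤ.+ + p          ≡⟨ swap (height w) (+ (ℓ ℕ.* p)) (+ p) ⟩
    height w ℤ.+ (+ p ℤ.+ + (ℓ ℕ.* p))          ≡⟨ cong (λ x → height w ℤ.+ x) (ℤ.pos-+ p (ℓ ℕ.* p)) ⟨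
    height w ℤ.+ + (suc ℓ ℕ.* p)                ∎
    where
    open ℤ.≤-Reasoning
    swap : ∀ x y z → (x ℤ.+ y) ℤ.+ z ≡ x ℤ.+ (z ℤ.+ y)
    swap = solve-∀

  -- `s` counts the steps before `w` and `t` those after it; only the height bounds they force are
  -- kept.
  Between : ℕ → Vertex → Vertex → Vertex → Set
  Between ℓ u v w = ∃₂ λ s t → s + t ≡ ℓ
    × height w ℤ.≤ height u ℤ.+ + (s ℕ.* q)
    × height w ℤ.≤ height v ℤ.+ + (t ℕ.* p)

  Between-◂ : ∀ {ℓ u u′ v w} → Step u u′ → Between ℓ u′ v w → Between (suc ℓ) u v w
  Between-◂ {ℓ} {u} {u′} {v} {w} σ (s , t , s+t≡ℓ , rise , fall) =
    suc s , t , cong suc s+t≡ℓ , rise′ , fall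
    where
    open ℤ.≤-Reasoning
    rise′ : height w ℤ.≤ height u ℤ.+ + (suc s ℕ.* q)
    rise′ = begin
      height w                                    ≤⟨ rise ⟩
      height u′ ℤ.+ + (s ℕ.* q)                   ≤⟨ ℤ.+-monoˡ-≤ (+ (s ℕ.* q)) (step-rise σ) ⟩
      (height u ℤ.+ + q) ℤ.+ + (s ℕ.* q)          ≡⟨ ℤ.+-assoc (height u) (+ q) (+ (s ℕ.* q)) ⟩
      height u ℤ.+ (+ q ℤ.+ + (s ℕ.* q))          ≡⟨ cong (λ x → height u ℤ.+ x) (ℤ.pos-+ q (s ℕ.* q)) ⟨
      height u ℤ.+ + (suc s ℕ.* q)                ∎

  -- The first vertex has every step after it, so `ends-fall` bounds it; for a later vertex,
  -- restoring the first step increases `s` alone.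
  vertices-between : ∀ {ℓ u v} (γ : Path ℓ u v) → All (Between ℓ u v) (vertices γ)
  vertices-between {u = u} (point _) =
    (0 , 0 , refl , ℤ.≤-reflexive (≡.sym (ℤ.+-identityʳ (height u)))
                  , ℤ.≤-reflexive (≡.sym (ℤ.+-identityʳ (height u)))) ∷ []
  vertices-between {v = w} (_◂_ {ℓ} {u} {v} s γ) =
    (0 , suc ℓ , refl , ℤ.≤-reflexive (≡.sym (ℤ.+-identityʳ (height u))) , ends-fall (s ◂ γ))
    ∷ All.map (λ {x} → Between-◂ {ℓ} {u} {v} {w} {x} s) (vertices-between γ)

  <+*⇒∸/< : ∀ {m i k} r .{{_ : NonZero r}} → i ≤ m → m ℕ.< i + k ℕ.* r → (m ∸ i) / r ℕ.< k
  <+*⇒∸/< {m} {i} {k} r i≤m m< = ℕ.m<n*o⇒m/o<n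
    (subst (m ∸ i ℕ.<_) (ℕ.m+n∸m≡n i (k ℕ.* r)) (ℕ.∸-monoˡ-< m< i≤m))

  below-ceiling : .{{_ : NonZero p}} .{{_ : NonZero q}} →
    ∀ {m i j ℓ s t w} → i ≤ m → j ≤ m → ℓ ≤ (m ∸ i) / q + (m ∸ j) / p + 1 →
    Between ℓ (s , + i) (t , + j) w → height w ℤ.≤ + m
  below-ceiling {m} {i} {j} {ℓ} {w = w} i≤m j≤m ℓ≤L (s , t , refl , rise , fall)
    with height w ℤ.≤? + m
  ... | yes w≤m = w≤m
  ... | no  w≰m = contradiction ℓ≤L (ℕ.<⇒≱ (begin-strict
      (m ∸ i) / q + (m ∸ j) / p + 1         ≡⟨ ℕ.+-comm _ 1 ⟩
      -- Each of `s` and `t` exceeds its quotient by at least one. The first excess absorbs the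
      -- `+ 1` of the length bound, the second makes the inequality strict.
      suc ((m ∸ i) / q) + (m ∸ j) / p       <⟨ ℕ.+-mono-≤-< s> t> ⟩
      s + t                                 ∎))
    where
    open ℕ.≤-Reasoning
    m<w = ℤ.≰⇒> w≰m
    s> : (m ∸ i) / q ℕ.< s
    s> = <+*⇒∸/< q i≤m (ℤ.drop‿+<+
      (subst (+ m ℤ.<_) (≡.sym (ℤ.pos-+ i (s ℕ.* q))) (ℤ.<-≤-trans m<w rise)))
    t> : (m ∸ j) / p ℕ.< t
    t> = <+*⇒∸/< p j≤m (ℤ.drop‿+<+
      (subst (+ m ℤ.<_) (≡.sym (ℤ.pos-+ j (t ℕ.* p))) (ℤ.<-≤-trans m<w fall)))

  𝒟ₙ≐𝒟 : .{{_ : NonZero p}} .{{_ : NonZero q}} →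
    ∀ {m i j ℓ} → i ≤ m → j ≤ m → ℓ ≤ (m ∸ i) / q + (m ∸ j) / p + 1 →
    𝒟ₙ ℓ i j (suc m) ≐ 𝒟 ℓ i j
  𝒟ₙ≐𝒟 {ℓ = ℓ} i≤m j≤m ℓ≤L = All.map proj₁ , λ {γ} nonneg →
    All.zip (nonneg , All.map (λ {w} → below-ceiling {s = 0} {t = ℓ} {w = w} i≤m j≤m ℓ≤L)
                            (vertices-between γ))

  vertices-head : ∀ {P : Pred Vertex 0ℓ} {ℓ u v} (γ : Path ℓ u v) → All P (vertices γ) → P u
  vertices-head (point _) (pu ∷ _) = pu
  vertices-head (_ ◂ _)   (pu ∷ _) = pu

  -- A path of length 0 from the k-th target to v exhibits v as that target.
  step-target : ∀ {u v} → Step u v → ∃ λ k → target u k ≡ v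
  step-target {u} {v} σ with Any.satisfied (∈-concatMap⁻ (λ k → map (stepBy u k ◂_) (paths 0 (target u k) v))
                                             {xs = List.allFin _} (∈-paths (σ ◂ point v)))
  ... | k , γ∈ with ∈-map⁻ (stepBy u k ◂_) γ∈
  ...   | point _ , _ , _ = k , refl

  target-injective : ∀ u {k k′} → height (target u k) ≡ height (target u k′) → k ≡ k′
  target-injective (_ , m) eq =
    Fin.toℕ-injective (ℤ.+-injective (ℤ-cancelʳ (ℤ.- (+ p)) _ _ (ℤ-cancelˡ m _ _ eq)))

module _ {c r} (K : CommutativeRing c r) where

  open CommutativeRing K
    using (Carrier; _≈_; 0#; 1#; setoid; semiring; reflexive; ring;
      +-cong; +-congˡ; +-identityˡ; +-identityʳ; +-assoc; -‿cong;
      *-cong; *-congˡ; *-congʳ; zeroˡ; zeroʳ; distribˡ)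
    renaming (_+_ to _+ᴷ_; _*_ to _*ᴷ_; -_ to -ᴷ_; _-_ to _-ᴷ_;
      refl to ≈-refl; sym to ≈-sym; trans to ≈-trans)
  open SemiringSum semiring using (sum; sum-cong-≋; ∑-comm; sum-replicate-zero)
  open Laurent K
  open import Relation.Binary.Reasoning.Setoid setoid

  -- Finite sums over indices and over filtered lists.

  sum-cong : ∀ {n} {f g : Fin n → Carrier} → (∀ k → f k ≈ g k) → sum f ≈ sum g
  sum-cong {n} {f} {g} = sum-cong-≋ {n} {f} {g}

  sum-≈0 : ∀ {n} {f : Fin n → Carrier} → (∀ k → f k ≈ 0#) → sum f ≈ 0#
  sum-≈0 {n} {f} f≈0 = ≈-trans (sum-cong {n} {f} f≈0) (sum-replicate-zero n)

  -- Letting `P` hold nowhere, at the price of `x ≈ 0#`, covers matched and unmatched indices of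
  -- `sum-match` at once.
  sum-unique : ∀ {n} {P : Pred (Fin n) 0ℓ} (P? : Decidable P) {x} →
    (∀ {k k′} → P k → P k′ → k ≡ k′) → ((∀ k → ¬ P k) → x ≈ 0#) →
    sum (λ k → if does (P? k) then x else 0#) ≈ x
  sum-unique {zero}  P? P-unique none = ≈-sym (none λ ())
  sum-unique {suc n} {P} P? {x} P-unique none with P? zero
  ... | yes p₀ = ≈-trans (+-congˡ (sum-≈0 λ k → reflexive
          (cong (λ b → if b then x else 0#) (dec-false (P? (suc k)) (λ pₖ → Fin.0≢1+n (P-unique p₀ pₖ))))))
        (+-identityʳ x)
  ... | no ¬p₀ = ≈-trans (+-identityˡ _)
        (sum-unique (P? ∘ suc) (λ p p′ → Fin.suc-injective (P-unique p p′))
          (λ ¬p → none (λ { zero → ¬p₀ ; (suc k) → ¬p k })))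

  -- Both sums are marginals of the array equal to x k = y l where R k l and to 0
  -- elsewhere.
  sum-match : ∀ {m n} {R : Fin m → Fin n → Set} (R? : ∀ k l → Dec (R k l))
    {x : Fin m → Carrier} {y : Fin n → Carrier} →
    (∀ {k l l′} → R k l → R k l′ → l ≡ l′) → (∀ {k k′ l} → R k l → R k′ l → k ≡ k′) →
    (∀ {k l} → R k l → x k ≈ y l) →
    (∀ k → (∀ l → ¬ R k l) → x k ≈ 0#) → (∀ l → (∀ k → ¬ R k l) → y l ≈ 0#) →
    sum x ≈ sum y
  sum-match R? {x} {y} uniqueʳ uniqueˡ x≈y x≈0 y≈0 = begin
    sum x
      ≈⟨ sum-cong (λ k → sum-unique (R? k) uniqueʳ (x≈0 k)) ⟨
    sum (λ k → sum (λ l → if does (R? k l) then x k else 0#))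
      ≈⟨ ∑-comm (λ k l → if does (R? k l) then x k else 0#) ⟩
    sum (λ l → sum (λ k → if does (R? k l) then x k else 0#))
      ≈⟨ sum-cong (λ l → sum-cong (λ k → entry k l)) ⟩
    sum (λ l → sum (λ k → if does (R? k l) then y l else 0#))
      ≈⟨ sum-cong (λ l → sum-unique (λ k → R? k l) uniqueˡ (y≈0 l)) ⟩
    sum y ∎
    where
    entry : ∀ k l → (if does (R? k l) then x k else 0#) ≈ (if does (R? k l) then y l else 0#)
    entry k l with R? k l
    ... | yes Rkl = x≈y Rkl
    ... | no  _   = ≈-refl

  -- `sumOver` unfolds to the case of `weight` on `paths ℓ u v`; an arbitrary list can be split by
  -- first step.
  sumFilter : ∀ {b} {B : Set b} {P : Pred B 0ℓ} →
    Decidable P → (B → Carrier) → List B → Carrier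
  sumFilter P? f xs = List.foldr _+ᴷ_ 0# (map f (filter P? xs))

  module _ {b} {B : Set b} where

    sumFilter-none : ∀ {P : Pred B 0ℓ} (P? : Decidable P) f xs → (∀ x → ¬ P x) →
      sumFilter P? f xs ≈ 0#
    sumFilter-none P? f xs ¬P = reflexive
      (cong (λ ys → List.foldr _+ᴷ_ 0# (map f ys)) (List.filter-none P? (All.universal ¬P xs)))

    sumFilter-++ : ∀ {P : Pred B 0ℓ} (P? : Decidable P) f xs ys →
      sumFilter P? f (xs ++ ys) ≈ sumFilter P? f xs +ᴷ sumFilter P? f ys
    sumFilter-++ P? f []       ys = ≈-sym (+-identityˡ _)
    sumFilter-++ P? f (x ∷ xs) ys with does (P? x)
    ... | true  = ≈-trans (+-congˡ (sumFilter-++ P? f xs ys)) (≈-sym (+-assoc _ _ _))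
    ... | false = sumFilter-++ P? f xs ys

    -- A general `h` carries the induction, since the tail of `tabulate h` is `tabulate (h ∘ suc)`;
    -- `allFin` is the case of the identity.
    sumFilter-concatMap-tabulate : ∀ {P : Pred B 0ℓ} (P? : Decidable P) f
      {a} {A : Set a} (g : A → List B) {n} (h : Fin n → A) →
      sumFilter P? f (concatMap g (tabulate h)) ≈ sum (λ k → sumFilter P? f (g (h k)))
    sumFilter-concatMap-tabulate P? f g {zero}  h = ≈-refl
    sumFilter-concatMap-tabulate P? f g {suc n} h = ≈-trans
      (sumFilter-++ P? f (g (h zero)) _)
      (+-congˡ (sumFilter-concatMap-tabulate P? f g (h ∘ suc)))

    -- Meant for `g` prefixing a fixed step: every weight gains the same factor `x`.
    sumFilter-map : ∀ {P : Pred B 0ℓ} (P? : Decidable P) f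
      {a} {A : Set a} {Q : Pred A 0ℓ} (Q? : Decidable Q) (f′ : A → Carrier) (g : A → B) x →
      (P ∘ g) ≐ Q → (∀ a → f (g a) ≈ x *ᴷ f′ a) → ∀ as →
      sumFilter P? f (map g as) ≈ x *ᴷ sumFilter Q? f′ as
    sumFilter-map P? f Q? f′ g x P≐Q f≈ [] = ≈-sym (zeroʳ x)
    sumFilter-map P? f Q? f′ g x P≐Q f≈ (a ∷ as) with P? (g a) | Q? a
    ... | yes _ | yes _ = ≈-trans
          (+-cong (f≈ a) (sumFilter-map P? f Q? f′ g x P≐Q f≈ as)) (≈-sym (distribˡ x _ _))
    ... | no  _ | no  _ = sumFilter-map P? f Q? f′ g x P≐Q f≈ as
    ... | yes p | no ¬q = contradiction (proj₁ P≐Q p) ¬q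
    ... | no ¬p | yes q = contradiction (proj₂ P≐Q q) ¬p

  -- Uniqueness of the resolvent.

  coeff-sumˢ-cong : ∀ {n} {f g : Fin n → Series} m → (∀ k → coeff (f k) m ≈ coeff (g k) m) →
    coeff (sumˢ f) m ≈ coeff (sumˢ g) m
  coeff-sumˢ-cong {zero}  m f≈g = ≈-refl
  coeff-sumˢ-cong {suc n} m f≈g = +-cong (f≈g zero) (coeff-sumˢ-cong m (f≈g ∘ suc))

  -- Each series has its own bound; applied along rows and then across them, this gives one exponent
  -- from which all entries of a matrix vanish.
  common-bound : ∀ {n} (f : Fin n → ℤ) → ∃ λ N → ∀ k → f k ℤ.< + N
  common-bound {zero}  f = 0 , λ ()
  common-bound {suc n} f with common-bound (f ∘ suc)
  ... | N , f< = suc ℤ.∣ f zero ∣ ℕ.⊔ N , λ where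
    zero    → ℤ.<-≤-trans (ℤ.≤-<-trans (i≤+∣i∣ (f zero)) (ℤ.+<+ ℕ.≤-refl)) (+≤+ (ℕ.m≤m⊔n _ N))
    (suc k) → ℤ.<-≤-trans (f< k) (+≤+ (ℕ.m≤n⊔m _ N))

  -- Comparing coefficients of z^m in (z I − M) R = I expresses the coefficient of
  -- z^{m-1} in R through those of z^m, and high coefficients vanish.
  rightInverse-unique : ∀ {n} {M : Matrix n} {R S : Matrixˢ n} →
    (∀ i j → ([z− M ]· R) i j ≈ˢ constˢ (δ i j)) →
    (∀ i j → ([z− M ]· S) i j ≈ˢ constˢ (δ i j)) →
    ∀ i j → R i j ≈ˢ S i j
  -- The induction runs on a natural number `t` with `N ≤ m + t`; the absolute value of `N - m` is
  -- such a `t` on either side of `N`.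
  rightInverse-unique {n} {M} {R} {S} invR invS i j m = agree ℤ.∣ + N ℤ.- m ∣ m
    (m-n≤o⇒m≤n+o (+ N) m (i≤+∣i∣ (+ N ℤ.- m))) i j
    where
    boundR : ∀ i → ∃ λ N → ∀ j → bound (R i j) ℤ.< + N
    boundR i = common-bound (bound ∘ R i)
    boundS : ∀ i → ∃ λ N → ∀ j → bound (S i j) ℤ.< + N
    boundS i = common-bound (bound ∘ S i)
    allR = common-bound (+_ ∘ proj₁ ∘ boundR)
    allS = common-bound (+_ ∘ proj₁ ∘ boundS)
    N : ℕ
    N = proj₁ allR ℕ.⊔ proj₁ allS
    R<N : ∀ i j → bound (R i j) ℤ.< + N
    R<N i j = ℤ.<-trans (proj₂ (boundR i) j)
      (ℤ.<-≤-trans (proj₂ allR i) (+≤+ (ℕ.m≤m⊔n _ (proj₁ allS))))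
    S<N : ∀ i j → bound (S i j) ℤ.< + N
    S<N i j = ℤ.<-trans (proj₂ (boundS i) j)
      (ℤ.<-≤-trans (proj₂ allS i) (+≤+ (ℕ.m≤n⊔m (proj₁ allR) _)))
    shift : ∀ m t → m ℤ.+ (1ℤ ℤ.+ t) ≡ (m ℤ.+ 1ℤ) ℤ.+ t
    shift = solve-∀
    unshift : ∀ m → (m ℤ.+ 1ℤ) ℤ.- 1ℤ ≡ m
    unshift = solve-∀
    agree : ∀ t m → + N ℤ.≤ m ℤ.+ + t → ∀ i j → coeff (R i j) m ≈ coeff (S i j) m
    agree zero m N≤m i j = ≈-trans
      (vanishes (R i j) m (ℤ.<-≤-trans (R<N i j) N≤m′))
      (≈-sym (vanishes (S i j) m (ℤ.<-≤-trans (S<N i j) N≤m′)))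
      where
      N≤m′ : + N ℤ.≤ m
      N≤m′ = subst (+ N ℤ.≤_) (ℤ.+-identityʳ m) N≤m
    agree (suc t) m N≤m i j = subst (λ k → coeff (R i j) k ≈ coeff (S i j) k) (unshift m)
      (RingProperties.+-cancelʳ ring (-ᴷ coeff (sumˢ (λ k → M i k • S k j)) m′) _ _ (begin
        coeff (R i j) (m′ ℤ.- 1ℤ) -ᴷ coeff (sumˢ (λ k → M i k • S k j)) m′
          ≈⟨ +-congˡ (-‿cong (coeff-sumˢ-cong m′ (λ k → *-congˡ (agree t m′ N≤m′ k j)))) ⟨
        coeff (R i j) (m′ ℤ.- 1ℤ) -ᴷ coeff (sumˢ (λ k → M i k • R k j)) m′
          ≈⟨ invR i j m′ ⟩
        coeff (constˢ (δ i j)) m′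
          ≈⟨ invS i j m′ ⟨
        coeff (S i j) (m′ ℤ.- 1ℤ) -ᴷ coeff (sumˢ (λ k → M i k • S k j)) m′ ∎))
      where
      m′ : ℤ
      m′ = m ℤ.+ 1ℤ
      N≤m′ : + N ℤ.≤ m′ ℤ.+ + t
      N≤m′ = subst (+ N ℤ.≤_) (≡.trans (cong (λ x → m ℤ.+ x) (ℤ.pos-+ 1 t)) (shift m (+ t))) N≤m

  expansion-unique : ∀ {n} {M : Matrix n} {R : Matrixˢ n} → IsResolvent M R →
    ∀ i j → R i j ≈ˢ expansion M i j
  expansion-unique {M = M} R-resolvent = rightInverse-unique {M = M}
    (IsResolvent.inverseʳ R-resolvent)
    (IsResolvent.inverseʳ (expansion-isResolvent M))

  -- Path sums as entries of powers of `H n`.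

  module _ (p q : ℕ) (a : ℤ → ℤ → Carrier) where

    open Paths p q
    open Weights K p q a using (stepWeight; weight; sumOver; H)

    -- The subscript of a weight is the lower end of the step: the initial height if the step does
    -- not fall, the final height if it does.
    stepWeight-⊓ : ∀ i j → stepWeight (+ i) (+ j) ≡ a (+ j ℤ.- + i) (+ (i ℕ.⊓ j))
    stepWeight-⊓ i j with + j ℤ.- + i in eq
    ... | + k = cong (a (+ k) ∘ +_) (≡.sym (ℕ.m≤n⇒m⊓n≡m
          (ℤ.drop‿+≤+ (ℤ.0≤i-j⇒j≤i (subst (0ℤ ℤ.≤_) (≡.sym eq) (+≤+ z≤n))))))
    ... | -[1+ k ] = cong (a -[1+ k ]) (≡.trans
          (≡.trans (cong (λ x → + i ℤ.+ x) (≡.sym eq)) (m+[n-m]≡n (+ i) (+ j)))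
          (cong +_ (≡.sym (ℕ.m≥n⇒m⊓n≡n
            (ℤ.drop‿+≤+ (ℤ.i-j≤0⇒i≤j (subst (ℤ._≤ 0ℤ) (≡.sym eq) ℤ.-≤+)))))))

    H-inRange : ∀ {n} (i j : Fin n) → InRange (+ toℕ j ℤ.- + toℕ i) →
      stepWeight (+ toℕ i) (+ toℕ j) ≡ H n i j
    H-inRange i j r = ≡.trans (stepWeight-⊓ (toℕ i) (toℕ j))
      (cong (λ b → if b then _ else 0#) (≡.sym (dec-true (inRange? _) r)))

    H-outOfRange : ∀ {n} (i j : Fin n) → ¬ InRange (+ toℕ j ℤ.- + toℕ i) → H n i j ≡ 0#
    H-outOfRange i j ¬r = cong (λ b → if b then _ else 0#) (dec-false (inRange? _) ¬r)

    module _ (n : ℕ) where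

      stays? : ∀ {ℓ u v} → Decidable (λ (γ : Path ℓ u v) → All (Within n) (vertices γ))
      stays? γ = All.all? (within? n) (vertices γ)

      -- `Aₙ ℓ i j n` is the case of endpoints `(0 , + i)` and `(ℓ , + j)`; free endpoints admit the
      -- tails left by removing a first step.
      W : ∀ ℓ u v → Carrier
      W ℓ u v = sumOver (stays? {ℓ} {u} {v})

      W-outside : ∀ ℓ {u v} → ¬ Within n u → W ℓ u v ≈ 0#
      W-outside ℓ {u} {v} ¬in = sumFilter-none stays? weight (paths ℓ u v)
        (λ γ → ¬in ∘ vertices-head {P = Within n} γ)

      W-point : ∀ {u v} → Within n u → u ≡ v → W 0 u v ≈ 1#
      W-point {u} {v} in-u u≡v with u ≟ᵛ v
      ... | no u≢v = contradiction u≡v u≢v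
      ... | yes refl = begin
        sumFilter stays? weight (point u ∷ [])
          ≡⟨ cong (List.foldr _+ᴷ_ 0# ∘ map weight)
               (List.filter-accept stays? {x = point u} {xs = []} (in-u ∷ [])) ⟩
        1# +ᴷ 0#
          ≈⟨ +-identityʳ 1# ⟩
        1# ∎

      W-distinct : ∀ {u v} → u ≢ v → W 0 u v ≈ 0#
      W-distinct {u} {v} u≢v with u ≟ᵛ v
      ... | no _    = ≈-refl
      ... | yes u≡v = contradiction u≡v u≢v

      -- `paths` groups paths of positive length by first step, and once `u` is in the strip a path
      -- stays there exactly when its tail does.
      W-suc : ∀ ℓ {u v} → Within n u →
        W (suc ℓ) u v ≈
          sum (λ k → stepWeight (height u) (height (target u k)) *ᴷ W ℓ (target u k) v)
      W-suc ℓ {u} {v} in-u = ≈-trans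
        (sumFilter-concatMap-tabulate stays? weight
          (λ k → map (stepBy u k ◂_) (paths ℓ (target u k) v)) (λ k → k))
        (sum-cong (λ k → sumFilter-map stays? weight stays? weight (stepBy u k ◂_) _
          ((λ { (_ ∷ in-γ) → in-γ }) , (in-u ∷_)) (λ γ → ≈-refl) (paths ℓ (target u k) v)))

      W≈H^ : ∀ ℓ {s t} (i j : Fin n) → t ≡ s + ℓ →
        W ℓ (s , + toℕ i) (t , + toℕ j) ≈ (H n ^ᴹ ℓ) i j
      W≈H^ zero {s} {t} i j t≡s with i Fin.≟ j
      ... | yes refl = W-point (within-toℕ s i)
            (cong (_, + toℕ i) (≡.sym (≡.trans t≡s (ℕ.+-identityʳ s))))
      ... | no i≢j   = W-distinct
            {s , + toℕ i} {t , + toℕ j} (i≢j ∘ Fin.toℕ-injective ∘ ℤ.+-injective ∘ cong proj₂)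
      W≈H^ (suc ℓ) {s} {t} i j t≡s+1+ℓ = ≈-trans (W-suc ℓ (within-toℕ s i))
        -- Step `k` is matched with the column `l` at whose height it ends. An unmatched step leaves
        -- the strip, so its path sum vanishes; an unmatched column lies outside the band of `H n`,
        -- so its entry vanishes.
        (sum-match (λ k l → height (target u k) ℤ.≟ + toℕ l)
          (λ eq eq′ → Fin.toℕ-injective (ℤ.+-injective (≡.trans (≡.sym eq) eq′)))
          (λ eq eq′ → target-injective {p} {q} u (≡.trans eq (≡.sym eq′)))
          (λ {k} {l} → matched k l)
          (λ k unmatched → ≈-trans
            (*-congˡ (W-outside ℓ (λ in-k → unmatched _ (proj₂ (toℕ-within n {target u k} in-k))))) (zeroʳ _))
          (λ l unmatched → ≈-trans (*-congʳ (reflexive (H-outOfRange i l λ r →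
            unmatched _ (cong proj₂ (proj₂ (step-target (step {u = u} {suc s , + toℕ l} refl r)))))))
            (zeroˡ _)))
        where
        u : Vertex
        u = s , + toℕ i
        matched : ∀ k l → height (target u k) ≡ + toℕ l →
          stepWeight (height u) (height (target u k)) *ᴷ W ℓ (target u k) (t , + toℕ j)
            ≈ H n i l *ᴷ (H n ^ᴹ ℓ) l j
        matched k l eq = *-cong
          (reflexive (≡.trans (cong (stepWeight (height u)) eq)
            (H-inRange i l (subst (λ h → InRange (h ℤ.- height u)) eq (Step.inRange (stepBy u k))))))
          (≈-trans (reflexive (cong (λ h → W ℓ (suc s , h) (t , + toℕ j)) eq))
            (W≈H^ ℓ l j (≡.trans t≡s+1+ℓ (ℕ.+-suc s ℓ))))

-- Comparison of the path sets, their weights and the two series.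

theorem7p2 : ∀ {c r} (K : CommutativeRing c r) (p q : ℕ) .{{_ : NonZero p}} .{{_ : NonZero q}}
    (a : ℤ → ℤ → CommutativeRing.Carrier K) →
    let open CommutativeRing K using (_≈_)
        open Weights K p q a
    in
    (n : ℕ) → n ≥ 1 → (i j : Fin n) →
    let L = (n ∸ 1 ∸ toℕ i) / q + (n ∸ 1 ∸ toℕ j) / p + 1 in
    (∀ ℓ → ℓ ≤ L →
      (𝒟ₙ ℓ (toℕ i) (toℕ j) n ≐ 𝒟 ℓ (toℕ i) (toℕ j)) ×
      (Aₙ ℓ (toℕ i) (toℕ j) n ≈ A ℓ (toℕ i) (toℕ j)))
    ×
    (∀ (R : Matrixˢ n) → IsResolvent (H n) R →
      (A[z] (toℕ i) (toℕ j) -ˢ R i j) =O[z^ ℤ.- (+ L) ℤ.- (+ 2) ])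
theorem7p2 K p q a n@(suc m) _ i j = (λ ℓ ℓ≤L → sets ℓ ℓ≤L , weights ℓ ℓ≤L) , remainder
  where
  open CommutativeRing K using (_≈_; 0#; reflexive; +-cong; -‿cong; -‿inverseʳ)
    renaming (refl to ≈-refl; sym to ≈-sym; trans to ≈-trans)
  open Weights K p q a
  L = (m ∸ toℕ i) / q + (m ∸ toℕ j) / p + 1
  sets : ∀ ℓ → ℓ ≤ L → 𝒟ₙ ℓ (toℕ i) (toℕ j) n ≐ 𝒟 ℓ (toℕ i) (toℕ j)
  sets ℓ = 𝒟ₙ≐𝒟 (ℕ.s≤s⁻¹ (Fin.toℕ<n i)) (ℕ.s≤s⁻¹ (Fin.toℕ<n j))
  weights : ∀ ℓ → ℓ ≤ L → Aₙ ℓ (toℕ i) (toℕ j) n ≈ A ℓ (toℕ i) (toℕ j)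
  -- Equivalent predicates filter `paths` to the same list, so the sums are equal already before
  -- passing to `≈`.
  weights ℓ ℓ≤L = reflexive (cong (List.foldr (CommutativeRing._+_ K) 0# ∘ map weight)
    (List.filter-≐ (𝒟ₙ? ℓ (toℕ i) (toℕ j) n) (𝒟? ℓ (toℕ i) (toℕ j)) (sets ℓ ℓ≤L)
      (paths ℓ (0 , + toℕ i) (ℓ , + toℕ j))))
  remainder : ∀ (R : Matrixˢ n) → IsResolvent (H n) R →
    (A[z] (toℕ i) (toℕ j) -ˢ R i j) =O[z^ ℤ.- (+ L) ℤ.- (+ 2) ]
  remainder R R-resolvent k k>-L-2 = ≈-trans (+-cong (agree k k>-L-2)
    (-‿cong (expansion-unique K R-resolvent i j k))) (-‿inverseʳ _)
    where
    agree : ∀ k → ℤ.- (+ L) ℤ.- (+ 2) ℤ.< k →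
      coeff (A[z] (toℕ i) (toℕ j)) k ≈ coeff (expansion (H n) i j) k
    agree (+ _)    _    = ≈-refl
    agree -[1+ ℓ ] k> = ≈-trans (≈-sym (weights ℓ ℓ≤L)) (W≈H^ K p q a n ℓ i j refl)
      where
      ℓ≤L : ℓ ≤ L
      -- The exponent `-L-2` is `-[1+ suc L ]`, so lying strictly above it means `ℓ < suc L`.
      ℓ≤L = ℕ.s≤s⁻¹ (ℤ.drop‿-<- (subst (ℤ._< -[1+ ℓ ]) (≡.trans
        (≡.sym (ℤ.neg-distrib-+ (+ L) (+ 2))) (cong (ℤ.-_ ∘ +_) (ℕ.+-comm L 2))) k>))
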